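{- There are posets with boolean dimension $4$ and unbounded local dimension. That is, for every positive integer $m$ there exists a poset whose boolean dimension is $4$ and whose local dimension is greater than $m$.
   Context: Let $P=(X,\leq)$ be a poset. Boolean dimension: a boolean realizer of $P$ is a set $\{\leq_1,\ldots,\leq_d\}$ of (arbitrary) linear orders on $X$ for which there is a $d$-ary boolean formula $\phi$ such that for all $x,y\in X$: $x\leq y$ if and only if $\phi\bigl((x\leq_1 y),\ldots,(x\leq_d y)\bigr)$ is true, where $(x\leq_i y)$ denotes the truth value of $x\leq_i y$. The boolean dimension of $P$ is the minimum size of a boolean realizer of $P$. Local dimension: a partial linear extension of $\leq$ is a linear extension of the restriction of $\leq$ to some subset of $X$. A local realizer of $P$ of width $d$ is a set $\{\leq_1,\ldots,\leq_t\}$ of partial linear extensions of $\leq$ such that every element of $X$ occurs in (the ground sets of) at most $d$ of $\leq_1,\ldots,\leq_t$, and for all $x,y\in X$: $x\leq y$ if and only if there is no $i\in\{1,\ldots,t\}$ with $x>_i y$ (where $x>_i y$ means that both $x$ and $y$ occur in $\leq_i$ and $x$ is strictly greater than $y$ there). The local dimension of $P$ is the minimum width of a local realizer of $P$. -}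

module Defs where

open import Data.Bool.Base using (true)
open import Data.Bool.Properties using (∨-∧-booleanAlgebra)
open import Data.Fin.Base using (Fin)
open import Data.Nat.Base as ℕ using (ℕ)
open import Data.Product.Base using (Σ-syntax; ∃; ∃-syntax; _×_; _,_; proj₁)
open import Data.Vec.Base using (allFin; count; tabulate)
open import Function.Base using (_on_)
open import Function.Bundles using (_⇔_)
open import Level using (Level; 0ℓ)
open import Relation.Binary.Bundles using (Poset)
open import Relation.Binary.Core using (Rel)
open import Relation.Binary.Definitions using (_Respects_)
open import Relation.Binary.PropositionalEquality.Core using (_≡_)
open import Relation.Binary.Structures using (IsDecTotalOrder; IsTotalOrder)
open import Relation.Nullary.Decidable using (⌊_⌋)
open import Relation.Nullary.Negation using (¬_)
open import Relation.Unary using (Pred; Decidable)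

import Algebra.Lattice.Properties.BooleanAlgebra.Expression ∨-∧-booleanAlgebra as Formula
import Function.Identity.Effectful as Identity
import Relation.Binary.Construct.NonStrictToStrict as Strict

open Formula using (Expr)
open Formula.Semantics Identity.applicative using (⟦_⟧)

IsMinimum : {ℓ : Level} → Pred ℕ ℓ → Pred ℕ ℓ
IsMinimum Q d = Q d × (∀ k → Q k → d ℕ.≤ k)

module _ (P : Poset 0ℓ 0ℓ 0ℓ) where
  open Poset P

  -- Decidable, so that x ≤ᵢ y has a truth value in Bool. The order
  -- need not be related to the order of P.
  record LinearOrder : Set₁ where
    field
      _≤ᵢ_            : Rel Carrier 0ℓ
      isDecTotalOrder : IsDecTotalOrder _≈_ _≤ᵢ_

    open IsDecTotalOrder isDecTotalOrder public
      using () renaming (_≤?_ to _≤ᵢ?_)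

  -- The d orders are an indexed family and may repeat; dropping
  -- repetitions only decreases d, so the minimum is the same as for sets.
  record BooleanRealizer (d : ℕ) : Set₁ where
    field
      order : Fin d → LinearOrder
      φ     : Expr d

    open module Order i = LinearOrder (order i) using (_≤ᵢ?_)

    field
      realizes : ∀ x y →
        x ≤ y ⇔ ⟦ φ ⟧ (tabulate λ i → ⌊ _≤ᵢ?_ i x y ⌋) ≡ true

  IsBooleanDimension : ℕ → Set₁
  IsBooleanDimension = IsMinimum BooleanRealizer

  -- The ground set is decidable, so that the orders in which a given
  -- element occurs can be counted.
  record PartialLinearExtension : Set₁ where
    field
      Ground      : Pred Carrier 0ℓ
      ground?     : Decidable Ground
      ground-resp : Ground Respects _≈_

    _≈ᵢ_ : Rel (∃ Ground) 0ℓ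
    _≈ᵢ_ = _≈_ on proj₁

    field
      _≤ᵢ_         : Rel (∃ Ground) 0ℓ
      isTotalOrder : IsTotalOrder _≈ᵢ_ _≤ᵢ_
      extends      : ∀ {p q} → proj₁ p ≤ proj₁ q → p ≤ᵢ q

    open Strict _≈ᵢ_ _≤ᵢ_ using () renaming (_<_ to _<ᵢ_)

    _>ᵢ_ : Rel Carrier 0ℓ
    x >ᵢ y = Σ[ x∈ ∈ Ground x ] Σ[ y∈ ∈ Ground y ] (y , y∈) <ᵢ (x , x∈)

  record LocalRealizer (d : ℕ) : Set₁ where
    field
      t         : ℕ
      extension : Fin t → PartialLinearExtension

    open module Extension i = PartialLinearExtension (extension i)
      using (ground?; _>ᵢ_)

    field
      width    : ∀ x → count (λ i → ground? i x) (allFin t) ℕ.≤ d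
      realizes : ∀ x y → x ≤ y ⇔ (¬ (∃[ i ] _>ᵢ_ i x y))

  IsLocalDimension : ℕ → Set₁
  IsLocalDimension = IsMinimum LocalRealizer

{-# OPTIONS --safe #-}
module Submission where

-- Take the intervals [p,q] and the points k of {0,…,n-1}, an interval lying
-- below exactly the points that it does not contain.  The relation "q < k or
-- k < p" is read off two linear orders, and two more separate the intervals
-- from the points, so the boolean dimension is at most 4; it is at least 4
-- because the singletons and the points form a standard example.
--
-- A partial linear extension that puts an interval I above a point of I cannot
-- do the same for an interval disjoint from I and one of its points.  Given a
-- local realizer of width d, split an interval I into d+1 blocks.  The at most
-- d extensions containing I miss some block, in the sense that none of them
-- reverses a pair inside it, yet each point k of this block lies in one of them,
-- namely one that reverses (I,k).  Iterating inside that block, after d+1 steps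
-- we find a point that lies in d+1 extensions.

open import Defs
open import Algebra.Lattice.Properties.BooleanAlgebra.Expression using (var; _and_; _or_; module Semantics)
open import Data.Bool.Base using (Bool; true; false; not; T; _∧_; _∨_; if_then_else_)
open import Data.Bool.Properties using (∨-∧-booleanAlgebra; ¬-not) renaming (_≟_ to _≟ᵇ_)
open import Data.Empty using (⊥)
open import Data.Fin.Base using (Fin; zero; suc; toℕ; fromℕ<; combine; remQuot; join; splitAt; inject≤; funToFin; finToFun)
open import Data.Fin.Patterns using (0F; 1F; 2F; 3F)
open import Data.Fin.Properties
  using ( _≟_; all?; any?; ¬∀⟶∃¬; pigeonhole; injective⇒≤; suc-injective; toℕ-injective; toℕ<n; toℕ-fromℕ<
        ; inject≤-injective; combine-injective; remQuot-combine; splitAt-join; finToFun-funToFin; 2↔Bool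
        ; <-cmp; <⇒≢)
open import Data.Fin.Subset using (Subset; ⊤; ∁)
open import Data.Fin.Subset.Properties using (anySubset?)
open import Data.List.Base using (List; []; _∷_)
open import Data.List.Relation.Unary.All as Allˡ using ([]; _∷_) renaming (All to Allˡ)
open import Data.Maybe.Base using (Maybe; just; nothing)
open import Data.Maybe.Properties as Maybe using (just-injective)
open import Data.Nat.Base as ℕ using (ℕ; zero; suc; pred; z≤n; s≤s; s≤s⁻¹; _+_; _*_; _^_; _≤_; _<_; NonZero)
import Data.Nat.Properties as ℕ
open import Data.Product.Base using (∃; Σ-syntax; ∃-syntax; _×_; _,_; proj₁; proj₂; uncurry; map; map₂)
open import Data.Sum.Base as Sum using (_⊎_; inj₁; inj₂)
open import Data.Unit.Base using (tt) renaming (⊤ to Unit)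
open import Data.Vec.Base using (Vec; []; _∷_; lookup; count; tabulate; allFin)
open import Data.Vec.Properties as Vec
  using (count≤n; lookup∘tabulate; tabulate∘lookup; tabulate-cong; tabulate-∘; lookup-replicate)
open import Data.Vec.Relation.Unary.All as All using (All; []; _∷_)
open import Data.Vec.Relation.Unary.All.Properties using (lookup⁺)
open import Data.Vec.Relation.Unary.AllPairs using ([]; _∷_)
open import Data.Vec.Relation.Unary.Unique.Propositional using (Unique)
open import Data.Vec.Relation.Unary.Unique.Propositional.Properties using (lookup-injective)
open import Function.Base using (_∘_; _on_; id)
open import Function.Bundles using (_⇔_; mk⇔; module Equivalence; module Inverse; module Injection)
open import Function.Properties.Inverse using (↔-sym; ↔⇒↣)
open import Level using (0ℓ)
open import Relation.Binary.Bundles using (Poset)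
open import Relation.Binary.Core using (Rel; _⇒_)
open import Relation.Binary.Definitions using (Decidable; tri<; tri≈; tri>)
open import Relation.Binary.PropositionalEquality hiding (poset)
open import Relation.Binary.Structures using (IsPartialOrder; IsTotalOrder; IsDecTotalOrder)
open import Relation.Nullary.Decidable hiding (map)
open import Relation.Nullary.Negation.Core using (¬_; contradiction)
import Function.Identity.Effectful as Identity
import Relation.Binary.Construct.Flip.EqAndOrd as Flip
import Relation.Binary.Construct.On as On
import Relation.Unary as Unary

open Semantics ∨-∧-booleanAlgebra Identity.applicative using (⟦_⟧)

-- Counting

module _ {a p} {A : Set a} {P : Unary.Pred A p} (P? : Unary.Decidable P) where

  rank : ∀ {n} (f : Fin n → A) i → P (f i) → Fin (count P? (tabulate f))
  rank {suc n} f i       p with P? (f zero)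
  rank {suc n} f zero    p | yes _ = zero
  rank {suc n} f zero    p | no ¬p = contradiction p ¬p
  rank {suc n} f (suc i) p | yes _ = suc (rank (f ∘ suc) i p)
  rank {suc n} f (suc i) p | no  _ = rank (f ∘ suc) i p

  rank-injective : ∀ {n} (f : Fin n → A) {i j} p q → rank f i p ≡ rank f j q → i ≡ j
  rank-injective {suc n} f {i}     {j}     p q eq with P? (f zero)
  rank-injective {suc n} f {zero}  {zero}  p q eq | yes _ = refl
  rank-injective {suc n} f {suc i} {suc j} p q eq | yes _ =
    cong suc (rank-injective (f ∘ suc) p q (suc-injective eq))
  rank-injective {suc n} f {zero}  {_}     p q eq | no ¬p = contradiction p ¬p
  rank-injective {suc n} f {suc i} {zero}  p q eq | no ¬p = contradiction q ¬p
  rank-injective {suc n} f {suc i} {suc j} p q eq | no _  =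
    cong suc (rank-injective (f ∘ suc) p q eq)

  unrank : ∀ {n} (f : Fin n → A) → Fin (count P? (tabulate f)) → ∃ (P ∘ f)
  unrank {suc n} f c       with P? (f zero)
  unrank {suc n} f zero    | yes p = zero , p
  unrank {suc n} f (suc c) | yes _ = map suc id (unrank (f ∘ suc) c)
  unrank {suc n} f c       | no  _ = map suc id (unrank (f ∘ suc) c)

  unrank-injective : ∀ {n} (f : Fin n → A) {c d} →
                     proj₁ (unrank f c) ≡ proj₁ (unrank f d) → c ≡ d
  unrank-injective {suc n} f {c}     {d}     eq with P? (f zero)
  unrank-injective {suc n} f {zero}  {zero}  eq | yes _ = refl
  unrank-injective {suc n} f {suc c} {suc d} eq | yes _ =
    cong suc (unrank-injective (f ∘ suc) (suc-injective eq))
  unrank-injective {suc n} f {c}     {d}     eq | no  _ =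
    unrank-injective (f ∘ suc) (suc-injective eq)

  injection⇒≤count : ∀ {m n} (f : Fin n → A) (g : Fin m → Fin n) →
                     (∀ {i j} → g i ≡ g j → i ≡ j) → (∀ i → P (f (g i))) →
                     m ≤ count P? (tabulate f)
  injection⇒≤count f g g-injective p =
    injective⇒≤ (g-injective ∘ rank-injective f (p _) (p _))

count-≤ : ∀ {p q m n} {P : Unary.Pred (Fin m) p} {Q : Unary.Pred (Fin n) q}
          (P? : Unary.Decidable P) (Q? : Unary.Decidable Q) (h : ∀ i → P i → Fin n) →
          (∀ i p → Q (h i p)) → (∀ {i j} p q → h i p ≡ h j q → i ≡ j) →
          count P? (allFin m) ≤ count Q? (allFin n)
count-≤ P? Q? h hQ h-injective =
  injection⇒≤count Q? id (λ c → h _ (proj₂ (unrank P? id c)))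
    (unrank-injective P? id ∘ h-injective _ _) (λ c → hQ _ _)

-- Constructively, a nonempty set of numbers has a least element once membership is decidable. For
-- the local dimension this calls for a decision procedure for local realizers.
least : ∀ {ℓ} {Q : ℕ → Set ℓ} → (∀ k → Dec (Q k)) → ∀ {n} → Q n → ∃ (IsMinimum Q)
least Q? {zero} q = zero , q , λ _ _ → z≤n
least Q? {suc n} q with Q? zero
... | yes q₀ = zero , q₀ , λ _ _ → z≤n
... | no ¬q₀ with d , qd , d-least ← least (Q? ∘ suc) {n} q = suc d , qd , λ where
  zero    q₀ → contradiction q₀ ¬q₀
  (suc k) qk → s≤s (d-least k qk)

-- Deciding whether a finite poset has a local realizer of given width

module FinitePoset {N : ℕ} {_⊑_ : Rel (Fin N) 0ℓ}
                   (⊑-isPartialOrder : IsPartialOrder _≡_ _⊑_) (_⊑?_ : Decidable _⊑_) where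

  poset : Poset 0ℓ 0ℓ 0ℓ
  poset = record { isPartialOrder = ⊑-isPartialOrder }

  open IsPartialOrder ⊑-isPartialOrder using () renaming (refl to ⊑-refl)

  -- The order of a partial linear extension, as a relation on all elements

  module _ (L : PartialLinearExtension poset) where
    open PartialLinearExtension L
    open IsTotalOrder isTotalOrder
      using (antisym; total) renaming (reflexive to ≤ᵢ-reflexive; trans to ≤ᵢ-trans)

    Below : Rel (Fin N) 0ℓ
    Below x y = Σ[ x∈ ∈ Ground x ] Σ[ y∈ ∈ Ground y ] (x , x∈) ≤ᵢ (y , y∈)

    below-refl : ∀ {x} → Ground x → Below x x
    below-refl x∈ = x∈ , x∈ , ≤ᵢ-reflexive refl

    below-trans : ∀ {x y z} → Below x y → Below y z → Below x z
    below-trans (x∈ , _ , x≤y) (_ , z∈ , y≤z) =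
      -- The two hypotheses may carry different proofs that `y` is in the ground set; reflexivity
      -- with respect to equality of the underlying elements bridges them.
      x∈ , z∈ , ≤ᵢ-trans x≤y (≤ᵢ-trans (≤ᵢ-reflexive refl) y≤z)

    below-antisym : ∀ {x y} → Below x y → Below y x → x ≡ y
    below-antisym (_ , _ , x≤y) (_ , _ , y≤x) =
      antisym x≤y (≤ᵢ-trans (≤ᵢ-reflexive refl) (≤ᵢ-trans y≤x (≤ᵢ-reflexive refl)))

    below-total : ∀ {x y} → Ground x → Ground y → Below x y ⊎ Below y x
    below-total x∈ y∈ with total (_ , x∈) (_ , y∈)
    ... | inj₁ x≤y = inj₁ (x∈ , y∈ , x≤y)
    ... | inj₂ y≤x = inj₂ (y∈ , x∈ , y≤x)

    -- No decision procedure comes with `_≤ᵢ_`, but totality yields one of the two comparisons, and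
    -- for distinct elements antisymmetry excludes the other.
    below? : Decidable Below
    below? x y with ground? x | ground? y
    ... | no x∉  | _      = no (x∉ ∘ proj₁)
    ... | yes _  | no y∉  = no (y∉ ∘ proj₁ ∘ proj₂)
    ... | yes x∈ | yes y∈ with below-total x∈ y∈ | x ≟ y
    ...   | inj₁ x≤y | _        = yes x≤y
    ...   | inj₂ _   | yes refl = yes (below-refl x∈)
    ...   | inj₂ y≤x | no x≢y   = no λ x≤y → x≢y (below-antisym x≤y y≤x)

    >ᵢ⇒below : ∀ {x y} → x >ᵢ y → Below y x
    >ᵢ⇒below (x∈ , y∈ , y≤x , _) = y∈ , x∈ , y≤x

    below⇒>ᵢ : ∀ {x y} → Below y x → y ≢ x → x >ᵢ y
    below⇒>ᵢ (y∈ , x∈ , y≤x) y≢x = x∈ , y∈ , y≤x , y≢x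

    >ᵢ⇒⋢ : ∀ {x y} → x >ᵢ y → ¬ x ⊑ y
    >ᵢ⇒⋢ x>y@(x∈ , y∈ , _ , y≢x) x⊑y =
      y≢x (below-antisym (>ᵢ⇒below x>y) (x∈ , y∈ , extends x⊑y))

    infix 4 _>ᵢ?_
    _>ᵢ?_ : Decidable _>ᵢ_
    x >ᵢ? y = map′ (uncurry below⇒>ᵢ) (λ { x>y@(_ , _ , _ , y≢x) → >ᵢ⇒below x>y , y≢x })
                   (below? y x ×-dec ¬? (y ≟ x))

    -- Otherwise the extension would contain the cycle `a`, `b′`, `a′`, `b`, `a`, each at most the
    -- next, which forces `a` and `b` to be equal.
    >ᵢ-no-cross : ∀ {a b a′ b′} → a >ᵢ b → a′ >ᵢ b′ → a ⊑ b′ → ¬ a′ ⊑ b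
    >ᵢ-no-cross a>b@(a∈ , b∈ , _ , b≢a) a′>b′@(a′∈ , b′∈ , _) a⊑b′ a′⊑b =
      b≢a (below-antisym (>ᵢ⇒below a>b)
        (below-trans (a∈ , b′∈ , extends a⊑b′)
          (below-trans (>ᵢ⇒below a′>b′) (a′∈ , b∈ , extends a′⊑b))))

  module Realizer {d} (R : LocalRealizer poset d) where
    open LocalRealizer R public
    open module Ext i = PartialLinearExtension (extension i) using (Ground; ground?; _>ᵢ_) public

    -- A realizer only refutes the absence of a reversal; the search through finitely many
    -- extensions with decidable `_>ᵢ_` turns this into a witness.
    reversing : ∀ {x y} → ¬ x ⊑ y → ∃[ i ] _>ᵢ_ i x y
    reversing {x} {y} x⋢y = decidable-stable (any? λ i → _>ᵢ?_ (extension i) x y)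
                                     (x⋢y ∘ Equivalence.from (realizes x y))

  -- A partial linear extension encoded by its order alone: the ground set
  -- consists of the x with r x x.
  IsPartialChain : Rel (Fin N) 0ℓ → Set
  IsPartialChain r =
    (∀ x y → (r x y → r x x × r y y) ×
             (r x y → r y x → x ≡ y) ×
             (r x x → r y y → (r x y ⊎ r y x) × (x ⊑ y → r x y))) ×
    (∀ x y z → r x y → r y z → r x z)

  isPartialChain? : ∀ {r} → Decidable r → Dec (IsPartialChain r)
  isPartialChain? r? =
    (all? λ x → all? λ y →
      (r? x y →-dec (r? x x ×-dec r? y y)) ×-dec
      (r? x y →-dec (r? y x →-dec (x ≟ y))) ×-dec
      (r? x x →-dec (r? y y →-dec ((r? x y ⊎-dec r? y x) ×-dec (x ⊑? y →-dec r? x y))))) ×-dec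
    (all? λ x → all? λ y → all? λ z → r? x y →-dec (r? y z →-dec r? x z))

  -- Since `¬ x ⊑ y` forces `x ≢ y`, the entry `r i y x` is a strict reversal. Conversely, chains
  -- extend `_⊑_`, so they never reverse a related pair.
  IsChainRealizer : ∀ {t} (k : ℕ) {r : Fin t → Rel (Fin N) 0ℓ} → (∀ i → Decidable (r i)) → Set
  IsChainRealizer {t} k {r} r? =
    (∀ x → count (λ i → r? i x x) (allFin t) ≤ k) ×
    (∀ i → IsPartialChain (r i)) ×
    (∀ x y → ¬ x ⊑ y → ∃[ i ] r i y x)

  isChainRealizer? : ∀ {t} k {r : Fin t → Rel (Fin N) 0ℓ} (r? : ∀ i → Decidable (r i)) →
                     Dec (IsChainRealizer k r?)
  isChainRealizer? k r? =
    (all? λ x → count (λ i → r? i x x) (allFin _) ℕ.≤? k) ×-dec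
    (all? λ i → isPartialChain? (r? i)) ×-dec
    (all? λ x → all? λ y → ¬? (x ⊑? y) →-dec any? λ i → r? i y x)

  fromPartialChain : ∀ {r} → Decidable r → IsPartialChain r → PartialLinearExtension poset
  fromPartialChain {r} r? (pairwise , transitive) = record
    { Ground       = λ x → r x x
    ; ground?      = λ x → r? x x
    ; ground-resp  = λ { refl x∈ → x∈ }
    ; _≤ᵢ_         = r on proj₁
    ; isTotalOrder = record
      { isPartialOrder = record
        { isPreorder = record
          { isEquivalence = record { refl = refl ; sym = sym ; trans = trans }
          ; reflexive     = λ { {_ , x∈} refl → x∈ }
          ; trans         = transitive _ _ _
          }
        ; antisym = λ {(x , _)} {(y , _)} → proj₁ (proj₂ (pairwise x y))
        }
      ; total = λ (x , x∈) (y , y∈) → proj₁ (proj₂ (proj₂ (pairwise x y)) x∈ y∈)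
      }
    ; extends = λ {(x , x∈)} {(y , y∈)} → proj₂ (proj₂ (proj₂ (pairwise x y)) x∈ y∈)
    }

  fromChainRealizer : ∀ {t k} {r : Fin t → Rel (Fin N) 0ℓ} (r? : ∀ i → Decidable (r i)) →
                      IsChainRealizer k r? → LocalRealizer poset k
  fromChainRealizer r? (bounded , chains , reverses) = record
    { t         = _
    ; extension = ext
    ; width     = bounded
    ; realizes  = λ x y → mk⇔
      (λ { x⊑y (i , x>y) → >ᵢ⇒⋢ (ext i) x>y x⊑y })
      (λ none → decidable-stable (x ⊑? y) λ x⋢y →
        let i , y≤x  = reverses x y x⋢y
            x∈ , y∈ = proj₁ (proj₁ (chains i) y x) y≤x
        in none (i , y∈ , x∈ , y≤x , λ { refl → x⋢y ⊑-refl }))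
    }
    where
    ext : Fin _ → PartialLinearExtension poset
    ext i = fromPartialChain (r? i) (chains i)

  -- One bit for each chain index and pair of elements: all families of `t` decidable relations
  -- become subsets of a finite set, which `anySubset?` can search.
  record Array (t : ℕ) : Set where
    constructor ⟨_⟩
    field cells : Subset (t * (N * N))

    cell : Fin t → Fin N → Fin N → Bool
    cell i x y = lookup cells (combine i (combine x y))

  open Array

  pack : ∀ {t} → (Fin t → Fin N → Fin N → Bool) → Array t
  pack s = ⟨ tabulate (uncurry (λ i → uncurry (s i) ∘ remQuot N) ∘ remQuot (N * N)) ⟩

  cell-pack : ∀ {t} (s : Fin t → Fin N → Fin N → Bool) i x y → cell (pack s) i x y ≡ s i x y
  cell-pack s i x y = begin
    cell (pack s) i x y
      ≡⟨ lookup∘tabulate _ (combine i (combine x y)) ⟩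
    uncurry (λ i → uncurry (s i) ∘ remQuot N) (remQuot (N * N) (combine i (combine x y)))
      ≡⟨ cong (uncurry (λ i → uncurry (s i) ∘ remQuot N)) (remQuot-combine i (combine x y)) ⟩
    uncurry (s i) (remQuot N (combine x y))
      ≡⟨ cong (uncurry (s i)) (remQuot-combine x y) ⟩
    s i x y ∎
    where open ≡-Reasoning

  Entry : ∀ {t} → Array t → Fin t → Rel (Fin N) 0ℓ
  Entry a i x y = T (cell a i x y)

  entry? : ∀ {t} (a : Array t) i → Decidable (Entry a i)
  entry? a i x y = T? _

  -- Empty chains do not contribute to the width, and the others can be
  -- numbered by an element x together with a rank among the ≤ k chains
  -- containing x, so N * k chains suffice.
  module _ {k} (R : LocalRealizer poset k) where
    open Realizer R

    place : ∀ {x} i → Ground i x → Fin k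
    place {x} i x∈ = inject≤ (rank (λ i → ground? i x) (λ i → i) i x∈) (width x)

    slot : Fin t → Maybe (Fin (N * k))
    slot i with any? (ground? i)
    ... | no  _        = nothing
    ... | yes (x , x∈) = just (combine x (place i x∈))

    slot-injective : ∀ {i j c} → slot i ≡ just c → slot j ≡ just c → i ≡ j
    slot-injective {i} {j} eq₁ eq₂ with any? (ground? i) | any? (ground? j)
    ... | yes (x , x∈) | yes (y , y∈)
      with refl , eq ← combine-injective x (place i x∈) y (place j y∈) (just-injective (trans eq₁ (sym eq₂)))
      = rank-injective (λ i → ground? i x) (λ i → i) x∈ y∈ (inject≤-injective _ _ _ _ eq)

    slot-nonempty : ∀ {i x} → Ground i x → ∃[ c ] slot i ≡ just c
    slot-nonempty {i} {x} x∈ with any? (ground? i)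
    ... | yes _    = _ , refl
    ... | no empty = contradiction (x , x∈) empty

    -- A number `c` that is the slot of no extension gives the empty relation, hence an empty chain.
    InSlot : Fin (N * k) → Rel (Fin N) 0ℓ
    InSlot c x y = ∃[ i ] slot i ≡ just c × Below (extension i) x y

    inSlot? : ∀ c → Decidable (InSlot c)
    inSlot? c x y = any? λ i → Maybe.≡-dec _≟_ (slot i) (just c) ×-dec below? (extension i) x y

    array : Array (N * k)
    array = pack λ c x y → isYes (inSlot? c x y)

    entry⁺ : ∀ c x y → InSlot c x y → Entry array c x y
    entry⁺ c x y p = subst T (sym (cell-pack (λ c x y → isYes (inSlot? c x y)) c x y)) (fromWitness p)

    entry⁻ : ∀ c x y → Entry array c x y → InSlot c x y
    entry⁻ c x y e = toWitness (subst T (cell-pack (λ c x y → isYes (inSlot? c x y)) c x y) e)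

    array-isChainRealizer : IsChainRealizer k (entry? array)
    array-isChainRealizer = bounded , chains , reverses
      where
      bounded : ∀ x → count (λ c → entry? array c x x) (allFin _) ≤ k
      bounded x = ℕ.≤-trans
        -- Each chain containing `x` is sent to the extension it came from; this is injective
        -- because `slot` recovers the chain's number.
        (count-≤ (λ c → entry? array c x x) (λ i → ground? i x)
          (λ c e → proj₁ (entry⁻ c x x e))
          (λ c e → proj₁ (proj₂ (proj₂ (entry⁻ c x x e))))
          (λ {c} {c′} e e′ eq → just-injective
            (trans (sym (proj₁ (proj₂ (entry⁻ c x x e))))
              (trans (cong slot eq) (proj₁ (proj₂ (entry⁻ c′ x x e′)))))))
        (width x)

      chains : ∀ c → IsPartialChain (Entry array c)
      chains c = (λ x y → ends x y , antisymmetric x y , compare x y) , transitive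
        where
        ends : ∀ x y → Entry array c x y → Entry array c x x × Entry array c y y
        ends x y e with i , eq , x∈ , y∈ , _ ← entry⁻ c x y e =
          entry⁺ c x x (i , eq , below-refl (extension i) x∈) , entry⁺ c y y (i , eq , below-refl (extension i) y∈)

        antisymmetric : ∀ x y → Entry array c x y → Entry array c y x → x ≡ y
        antisymmetric x y e e′ with i , eq , p ← entry⁻ c x y e | j , eq′ , q ← entry⁻ c y x e′
          with refl ← slot-injective eq eq′ = below-antisym (extension i) p q

        transitive : ∀ x y z → Entry array c x y → Entry array c y z → Entry array c x z
        transitive x y z e e′ with i , eq , p ← entry⁻ c x y e | j , eq′ , q ← entry⁻ c y z e′
          with refl ← slot-injective eq eq′ = entry⁺ c x z (i , eq , below-trans (extension i) p q)

        compare : ∀ x y → Entry array c x x → Entry array c y y →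
                  (Entry array c x y ⊎ Entry array c y x) × (x ⊑ y → Entry array c x y)
        compare x y e e′ with i , eq , x∈ , _ ← entry⁻ c x x e | j , eq′ , y∈ , _ ← entry⁻ c y y e′
          with refl ← slot-injective eq eq′ =
            Sum.map (λ p → entry⁺ c x y (i , eq , p)) (λ p → entry⁺ c y x (i , eq , p))
                    (below-total (extension i) x∈ y∈) ,
            λ x⊑y → entry⁺ c x y (i , eq , x∈ , y∈ , PartialLinearExtension.extends (extension i) x⊑y)

      reverses : ∀ x y → ¬ x ⊑ y → ∃[ c ] Entry array c y x
      reverses x y x⋢y with i , x>y ← reversing x⋢y
        with c , eq ← slot-nonempty (proj₁ x>y) =
          c , entry⁺ c y x (i , eq , >ᵢ⇒below (extension i) x>y)

  localRealizer? : ∀ k → Dec (LocalRealizer poset k)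
  localRealizer? k = map′ (λ (a , isR) → fromChainRealizer (entry? ⟨ a ⟩) isR)
                          (λ R → cells (array R) , array-isChainRealizer R)
                          (anySubset? λ a → isChainRealizer? k (entry? {N * k} ⟨ a ⟩))

  totalOrder⇒extension : ∀ {_≤_ : Rel (Fin N) 0ℓ} → IsTotalOrder _≡_ _≤_ → _⊑_ ⇒ _≤_ →
                         PartialLinearExtension poset
  totalOrder⇒extension {_≤_} O ⊑⇒≤ = record
    { Ground       = λ _ → Unit
    ; ground?      = λ _ → yes tt
    ; ground-resp  = λ _ _ → tt
    ; _≤ᵢ_         = _≤_ on proj₁
    ; isTotalOrder = On.isTotalOrder proj₁ O
    ; extends      = ⊑⇒≤
    }

-- Boolean realizers of standard examples

-- d, x, y and z are the vectors of truth values, in k linear orders, of a ≤ b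
-- (assumed equal to that of a′ ≤ b′), a ≤ b′, a′ ≤ b and a ≤ a′.
Compatible : ∀ {k} (d x y z : Subset k) → Set
Compatible {k} d x y z = ∀ (i : Fin k) →
  (lookup x i ≢ lookup d i → lookup z i ≢ lookup d i) ×
  (lookup y i ≢ lookup d i → lookup z i ≡ lookup d i)

compatible? : ∀ {k} (d x y z : Subset k) → Dec (Compatible d x y z)
compatible? d x y z = all? λ i →
  (¬? (lookup x i ≟ᵇ lookup d i) →-dec ¬? (lookup z i ≟ᵇ lookup d i)) ×-dec
  (¬? (lookup y i ≟ᵇ lookup d i) →-dec (lookup z i ≟ᵇ lookup d i))

Separated : ∀ {k} → List (Subset k) → List (Subset k) → Set
Separated us vs = Allˡ (λ u → Allˡ (u ≢_) vs) us

separated? : ∀ {k} (us vs : List (Subset k)) → Dec (Separated us vs)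
separated? us vs = Allˡ.all? (λ u → Allˡ.all? (λ v → ¬? (Vec.≡-dec _≟ᵇ_ u v)) vs) us

-- In a standard example, a boolean formula has to accept the first three vectors
-- (⊤ by reflexivity) and to reject the other six.
Consistent : ℕ → Set
Consistent k = ∃[ d ] ∃[ x ] ∃[ y ] ∃[ z ] Compatible {k} d x y z ×
  Separated (⊤ ∷ x ∷ y ∷ []) (d ∷ ∁ d ∷ ∁ x ∷ ∁ y ∷ z ∷ ∁ z ∷ [])

consistent? : ∀ k → Dec (Consistent k)
consistent? k = anySubset? λ d → anySubset? λ x → anySubset? λ y → anySubset? λ z →
  compatible? d x y z ×-dec separated? _ _

-- An exhaustive search by computation, through at most `2 ^ 12` quadruples of truth vectors.
inconsistent : ∀ {k} → k < 4 → ¬ Consistent k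
inconsistent {0} _ = from-no (consistent? 0)
inconsistent {1} _ = from-no (consistent? 1)
inconsistent {2} _ = from-no (consistent? 2)
inconsistent {3} _ = from-no (consistent? 3)
inconsistent {suc (suc (suc (suc _)))} (s≤s (s≤s (s≤s (s≤s ()))))

-- Truth values of comparisons in one linear order

module _ {X : Set} {_≈_ _≤_ : X → X → Set} (O : IsDecTotalOrder _≈_ _≤_) where
  open IsDecTotalOrder O renaming (trans to ≤-trans) using (antisym; total; _≤?_)

  ≰⇒≥ : ∀ {x y} → ¬ x ≤ y → y ≤ x
  ≰⇒≥ {x} {y} x≰y with total x y
  ... | inj₁ x≤y = contradiction x≤y x≰y
  ... | inj₂ y≤x = y≤x

  isYes-swap : ∀ {x y} → ¬ x ≈ y → isYes (y ≤? x) ≡ not (isYes (x ≤? y))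
  isYes-swap {x} {y} x≉y with x ≤? y | y ≤? x
  ... | yes x≤y | yes y≤x = contradiction (antisym x≤y y≤x) x≉y
  ... | yes _   | no  _   = refl
  ... | no  _   | yes _   = refl
  ... | no  x≰y | no  y≰x = contradiction (≰⇒≥ x≰y) y≰x

  -- If `a ≤ b′` differs in truth value from `a ≤ b`, then `b′` lies between `a` and `a′`; if
  -- `a′ ≤ b` does, then `b` lies between them. Either position settles how `a` and `a′` compare,
  -- with opposite outcomes.
  isYes-cross : ∀ {a b a′ b′} → ¬ a ≈ a′ → isYes (a ≤? b) ≡ isYes (a′ ≤? b′) →
    (isYes (a ≤? b′) ≢ isYes (a ≤? b) → isYes (a ≤? a′) ≢ isYes (a ≤? b)) ×
    (isYes (a′ ≤? b) ≢ isYes (a ≤? b) → isYes (a ≤? a′) ≡ isYes (a ≤? b))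
  isYes-cross {a} {b} {a′} {b′} a≉a′ eq = first , second
    where
    first : isYes (a ≤? b′) ≢ isYes (a ≤? b) → isYes (a ≤? a′) ≢ isYes (a ≤? b)
    first ne with a ≤? b | a′ ≤? b′ | a ≤? b′ | a ≤? a′
    ... | yes _   | yes a′≤b′ | no a≰b′ | yes a≤a′ = contradiction (≤-trans a≤a′ a′≤b′) a≰b′
    ... | no _    | no a′≰b′ | yes a≤b′ | no a≰a′ = contradiction (≤-trans a≤b′ (≰⇒≥ a′≰b′)) a≰a′
    ... | yes _   | _ | yes _ | _     = contradiction refl ne
    ... | no _    | _ | no _  | _     = contradiction refl ne
    ... | yes _   | _ | no _  | no _  = λ ()
    ... | no _    | _ | yes _ | yes _ = λ ()

    second : isYes (a′ ≤? b) ≢ isYes (a ≤? b) → isYes (a ≤? a′) ≡ isYes (a ≤? b)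
    second ne with a ≤? b | a′ ≤? b | a ≤? a′
    ... | yes a≤b | no a′≰b  | no a≰a′  =
      contradiction (≤-trans a≤b (≰⇒≥ a′≰b)) a≰a′
    ... | no a≰b  | yes a′≤b | yes a≤a′ = contradiction (≤-trans a≤a′ a′≤b) a≰b
    ... | yes _   | yes _    | _        = contradiction refl ne
    ... | no _    | no _     | _        = contradiction refl ne
    ... | yes _   | no _     | yes _    = refl
    ... | no _    | yes _    | no _     = refl

funToFin-injective : ∀ {m n} {f g : Fin m → Fin n} → funToFin f ≡ funToFin g → ∀ i → f i ≡ g i
funToFin-injective {f = f} {g} eq i =
  trans (sym (finToFun-funToFin f i)) (trans (cong (λ c → finToFun c i) eq) (finToFun-funToFin g i))

module StandardExample (P : Poset 0ℓ 0ℓ 0ℓ) where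
  open Poset P using (Carrier; _≈_) renaming (_≤_ to _⊑_)

  -- With 9 > 2 ^ 3 pairs, two of the pairs (a i , b i) have the same truth vector.
  module _ (a b : Fin 9 → Carrier)
           (a⊑b : ∀ {i j} → i ≢ j → a i ⊑ b j)
           (a⋢b : ∀ {i} → ¬ a i ⊑ b i)
           (b⋢a : ∀ {i j} → ¬ b j ⊑ a i)
           (a⋢a : ∀ {i j} → i ≢ j → ¬ a i ⊑ a j)
           where

    4≤booleanDimension : ∀ k → BooleanRealizer P k → 4 ≤ k
    4≤booleanDimension k R = ℕ.≮⇒≥ λ k<4 → inconsistent k<4 (consistent k<4)
      where
      open BooleanRealizer R
      open module Orders i = LinearOrder (order i) using (_≤ᵢ?_; isDecTotalOrder)
      open Poset.Eq P using () renaming (sym to ≈-sym)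

      bits : Carrier → Carrier → Fin k → Bool
      bits x y i = isYes (_≤ᵢ?_ i x y)

      vec : Carrier → Carrier → Subset k
      vec x y = tabulate (bits x y)

      holds : Subset k → Bool
      holds = ⟦ φ ⟧

      holds⁺ : ∀ {x y} → x ⊑ y → holds (vec x y) ≡ true
      holds⁺ = Equivalence.to (realizes _ _)

      holds⁻ : ∀ {x y} → ¬ x ⊑ y → holds (vec x y) ≡ false
      holds⁻ x⋢y = ¬-not (x⋢y ∘ Equivalence.from (realizes _ _))

      vec-refl : ∀ x → vec x x ≡ ⊤
      vec-refl x = trans (tabulate-cong bits-refl) (tabulate∘lookup ⊤)
        where
        bits-refl : ∀ i → bits x x i ≡ lookup ⊤ i
        bits-refl i = trans (isYes≗does (_≤ᵢ?_ i x x))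
                            (trans (dec-true (_≤ᵢ?_ i x x) (IsDecTotalOrder.refl (isDecTotalOrder i)))
                                                  (sym (lookup-replicate i true)))

      -- In every linear order exactly one of two distinct elements precedes the other, so the swap
      -- flips each bit.
      vec-swap : ∀ {x y} → ¬ x ≈ y → vec y x ≡ ∁ (vec x y)
      vec-swap x≉y = trans (tabulate-cong (λ i → isYes-swap (isDecTotalOrder i) x≉y))
                           (tabulate-∘ not _)

      a≉b : ∀ {i j} → ¬ a i ≈ b j
      a≉b = b⋢a ∘ Poset.reflexive P ∘ ≈-sym

      ⊤-holds : holds ⊤ ≡ true
      ⊤-holds = trans (cong holds (sym (vec-refl (a zero)))) (holds⁺ (Poset.refl P))

      ∁-fails : ∀ {x y} → ¬ x ≈ y → ¬ y ⊑ x → holds (∁ (vec x y)) ≡ false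
      ∁-fails x≉y y⋢x = trans (cong holds (sym (vec-swap x≉y))) (holds⁻ y⋢x)

      separated : ∀ {us vs} → Allˡ ((_≡ true) ∘ holds) us → Allˡ ((_≡ false) ∘ holds) vs → Separated us vs
      separated ts fs = Allˡ.map (λ t → Allˡ.map (λ { f refl → contradiction (trans (sym t) f) λ () }) fs) ts

      toFin : Bool → Fin 2
      toFin = Inverse.from 2↔Bool

      consistent : k < 4 → Consistent k
      consistent k<4 with pigeonhole (s≤s (ℕ.^-monoʳ-≤ 2 (s≤s⁻¹ k<4))) (λ i → funToFin (toFin ∘ bits (a i) (b i)))
      ... | i , j , i<j , eq =
        vec (a i) (b i) , vec (a i) (b j) , vec (a j) (b i) , vec (a i) (a j) , compatible ,
        separated (⊤-holds ∷ holds⁺ (a⊑b i≢j) ∷ holds⁺ (a⊑b (≢-sym i≢j)) ∷ [])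
          ( holds⁻ a⋢b ∷ ∁-fails a≉b b⋢a ∷ ∁-fails a≉b b⋢a ∷ ∁-fails a≉b b⋢a
          ∷ holds⁻ (a⋢a i≢j) ∷ ∁-fails (a⋢a i≢j ∘ Poset.reflexive P) (a⋢a (≢-sym i≢j)) ∷ [])
        where
        i≢j : i ≢ j
        i≢j = <⇒≢ i<j

        bits-diagonal : ∀ c → bits (a i) (b i) c ≡ bits (a j) (b j) c
        bits-diagonal c = Injection.injective (↔⇒↣ (↔-sym 2↔Bool)) (funToFin-injective eq c)

        compatible : Compatible (vec (a i) (b i)) (vec (a i) (b j)) (vec (a j) (b i)) (vec (a i) (a j))
        compatible c
          rewrite lookup∘tabulate (bits (a i) (b i)) c | lookup∘tabulate (bits (a i) (b j)) c
                | lookup∘tabulate (bits (a j) (b i)) c | lookup∘tabulate (bits (a i) (a j)) c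
          = isYes-cross (isDecTotalOrder c) (a⋢a i≢j ∘ Poset.reflexive P) (bits-diagonal c)

-- Intervals and points

module Key {N : ℕ} (f : Fin N → ℕ) where

  -- The lexicographic order by `f` and then by index, encoded in one number: `toℕ x` is a last
  -- digit in base `N`. The index breaks ties of `f`, so the order is linear.
  key : Fin N → ℕ
  key x = f x * N + toℕ x

  key-mono-< : ∀ {x y} → f x < f y → key x < key y
  key-mono-< {x} {y} fx<fy = begin-strict
    f x * N + toℕ x <⟨ ℕ.+-monoʳ-< (f x * N) (toℕ<n x) ⟩
    f x * N + N     ≡⟨ ℕ.+-comm (f x * N) N ⟩
    suc (f x) * N   ≤⟨ ℕ.*-monoˡ-≤ N fx<fy ⟩
    f y * N         ≤⟨ ℕ.m≤m+n (f y * N) (toℕ y) ⟩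
    key y           ∎
    where open ℕ.≤-Reasoning

  key-cancel-≤ : ∀ {x y} → key x ≤ key y → f x ≤ f y
  key-cancel-≤ kx≤ky = ℕ.≮⇒≥ λ fy<fx → ℕ.<⇒≱ (key-mono-< fy<fx) kx≤ky

  key-tie : ∀ {x y} → f x ≡ f y → key x ≤ key y → toℕ x ≤ toℕ y
  key-tie {x} {y} eq kx≤ky = ℕ.+-cancelˡ-≤ (f x * N) _ _
    (subst (λ c → key x ≤ c * N + toℕ y) (sym eq) kx≤ky)

  key-injective : ∀ {x y} → key x ≡ key y → x ≡ y
  key-injective eq = toℕ-injective (ℕ.≤-antisym (key-tie fx≡fy (ℕ.≤-reflexive eq))
                                                (key-tie (sym fx≡fy) (ℕ.≤-reflexive (sym eq))))
    where fx≡fy = ℕ.≤-antisym (key-cancel-≤ (ℕ.≤-reflexive eq)) (key-cancel-≤ (ℕ.≤-reflexive (sym eq)))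

  infix 4 _≲_
  _≲_ : Rel (Fin N) 0ℓ
  _≲_ = ℕ._≤_ on key

  isDecTotalOrder : IsDecTotalOrder _≡_ _≲_
  isDecTotalOrder = record
    { isTotalOrder = record
      { isPartialOrder = record
        { isPreorder = record
          { isEquivalence = isEquivalence
          ; reflexive     = ℕ.≤-reflexive ∘ cong key
          ; trans         = ℕ.≤-trans
          }
        ; antisym = λ x≲y y≲x → key-injective (ℕ.≤-antisym x≲y y≲x)
        }
      ; total = λ x y → ℕ.≤-total (key x) (key y)
      }
    ; _≟_  = _≟_
    ; _≤?_ = λ x y → key x ℕ.≤? key y
    }

-- Labels, their order, and numerical functions on them

data Label : Set where
  interval : (p q : ℕ) → Label
  point    : (k : ℕ) → Label

data _⋖_ : Rel Label 0ℓ where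
  after  : ∀ {p q k} → q < k → interval p q ⋖ point k
  before : ∀ {p q k} → k < p → interval p q ⋖ point k

infix 4 _⋖_ _⋖?_

_⋖?_ : Decidable _⋖_
interval p q ⋖? point k with q ℕ.<? k | k ℕ.<? p
... | yes q<k | _       = yes (after q<k)
... | no _    | yes k<p = yes (before k<p)
... | no q≮k  | no k≮p  = no λ { (after q<k) → q≮k q<k ; (before k<p) → k≮p k<p }
interval _ _ ⋖? interval _ _ = no λ ()
point _      ⋖? _            = no λ ()

-- The relation leads only from intervals to points, so transitivity and antisymmetry of the poset
-- reduce to the trivial cases.
⋖-no-chain : ∀ {a b c} → a ⋖ b → ¬ b ⋖ c
⋖-no-chain (after _)  ()
⋖-no-chain (before _) ()

-- `kind` and `cokind` separate intervals from points in opposite senses. `upper` places an interval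
-- below exactly the points beyond its right end, `lower` above exactly the points before its left
-- end. The opposite parities exclude ties: a point at an end of the interval counts as contained.
kind cokind upper lower : Label → ℕ
kind   (interval _ _) = 0
kind   (point _)      = 1
cokind (interval _ _) = 1
cokind (point _)      = 0
upper  (interval p q) = suc (2 * q)
upper  (point k)      = 2 * k
lower  (interval p q) = 2 * p
lower  (point k)      = suc (2 * k)

1+2m<2n : ∀ {m n} → m < n → suc (2 * m) < 2 * n
1+2m<2n {m} {n} m<n = begin
  2 + 2 * m ≡⟨ ℕ.*-suc 2 m ⟨
  2 * suc m ≤⟨ ℕ.*-monoʳ-≤ 2 m<n ⟩
  2 * n     ∎
  where open ℕ.≤-Reasoning

1+2m≤2n⇒m<n : ∀ {m n} → suc (2 * m) ≤ 2 * n → m < n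
1+2m≤2n⇒m<n {m} {n} = ℕ.*-cancelˡ-< 2 m n

kind≡⇒cokind≡ : ∀ {a b} → kind a ≡ kind b → cokind a ≡ cokind b
kind≡⇒cokind≡ {interval _ _} {interval _ _} _ = refl
kind≡⇒cokind≡ {point _}      {point _}      _ = refl

-- The height, in a linear extension, of an element x with label a; A says that
-- x is a fixed element v, and B that v ⊑ x.  If v is an interval, then it is
-- placed above the points that it contains and below all other points.
heightAt : ∀ {A B : Set} → Label → Dec A → Dec B → ℕ
heightAt (interval _ _) a? b? = if does a? then 2 else 0
heightAt (point _)      a? b? = if does b? then 3 else 1

-- Only the fixed interval has height 2, and the points above it have height 3; any other interval
-- has height 0, below all points.
heightAt-mono : ∀ {A B C D : Set} {a b} → a ⋖ b →
  (a? : Dec A) (b? : Dec B) (c? : Dec C) (d? : Dec D) → (A → D) →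
  heightAt a a? b? < heightAt b c? d?
heightAt-mono {a = interval _ _} {point _} _ (yes a) _ _ (no ¬d) A→D = contradiction (A→D a) ¬d
heightAt-mono {a = interval _ _} {point _} _ (yes _) _ _ (yes _) _   = s≤s (s≤s (s≤s z≤n))
heightAt-mono {a = interval _ _} {point _} _ (no _)  _ _ (yes _) _   = s≤s z≤n
heightAt-mono {a = interval _ _} {point _} _ (no _)  _ _ (no _)  _   = s≤s z≤n

heightAt-contained : ∀ {A B C D : Set} {a b} → kind a < kind b →
  (a? : Dec A) (b? : Dec B) (c? : Dec C) (d? : Dec D) → A → ¬ D →
  heightAt b c? d? < heightAt a a? b?
heightAt-contained {a = interval _ _} {point _} _ (yes _) _ _ (no _)  _ _  = s≤s (s≤s z≤n)
heightAt-contained {a = interval _ _} {point _} _ (no ¬a) _ _ _       a _  = contradiction a ¬a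
heightAt-contained {a = interval _ _} {point _} _ (yes _) _ _ (yes d) _ ¬d = contradiction d ¬d
heightAt-contained {a = point _}      {point _} (s≤s ())

module IntervalPoset {N : ℕ} (label : Fin N → Label) where

  infix 4 _⊑_ _⊑?_
  _⊑_ : Rel (Fin N) 0ℓ
  x ⊑ y = x ≡ y ⊎ label x ⋖ label y

  _⊑?_ : Decidable _⊑_
  x ⊑? y = (x ≟ y) ⊎-dec (label x ⋖? label y)

  ⊑-isPartialOrder : IsPartialOrder _≡_ _⊑_
  ⊑-isPartialOrder = record
    { isPreorder = record
      { isEquivalence = isEquivalence
      ; reflexive     = inj₁
      ; trans         = λ where
          (inj₁ refl) y⊑z         → y⊑z
          x⊑y         (inj₁ refl) → x⊑y
          (inj₂ x⋖y)  (inj₂ y⋖z)  → contradiction y⋖z (⋖-no-chain x⋖y)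
      }
    ; antisym = λ where
        (inj₁ x≡y) _          → x≡y
        _          (inj₁ y≡x) → sym y≡x
        (inj₂ x⋖y) (inj₂ y⋖x) → contradiction y⋖x (⋖-no-chain x⋖y)
    }

  open FinitePoset ⊑-isPartialOrder _⊑?_ public

  -- The boolean realizer with four orders

  module K₁ = Key (kind ∘ label)
  module K₂ = Key (cokind ∘ label)
  module K₃ = Key (upper ∘ label)
  module K₄ = Key (lower ∘ label)

  ⊑⇒≲₁ : ∀ {x y} → x ⊑ y → x K₁.≲ y
  ⊑⇒≲₁ (inj₁ refl) = ℕ.≤-refl
  ⊑⇒≲₁ (inj₂ x⋖y)  = ℕ.<⇒≤ (K₁.key-mono-< (kind-mono x⋖y))
    where
    kind-mono : ∀ {a b} → a ⋖ b → kind a < kind b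
    kind-mono (after _)  = s≤s z≤n
    kind-mono (before _) = s≤s z≤n

  ⊑⇒≳₂ : ∀ {x y} → x ⊑ y → y K₂.≲ x
  ⊑⇒≳₂ (inj₁ refl) = ℕ.≤-refl
  ⊑⇒≳₂ (inj₂ x⋖y)  = ℕ.<⇒≤ (K₂.key-mono-< (cokind-mono x⋖y))
    where
    cokind-mono : ∀ {a b} → a ⋖ b → cokind b < cokind a
    cokind-mono (after _)  = s≤s z≤n
    cokind-mono (before _) = s≤s z≤n

  ⊑⇒≲₃⊎≳₄ : ∀ {x y} → x ⊑ y → x K₃.≲ y ⊎ y K₄.≲ x
  ⊑⇒≲₃⊎≳₄ (inj₁ refl) = inj₁ ℕ.≤-refl
  ⊑⇒≲₃⊎≳₄ (inj₂ x⋖y)  = Sum.map (ℕ.<⇒≤ ∘ K₃.key-mono-<) (ℕ.<⇒≤ ∘ K₄.key-mono-<) (split x⋖y)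
    where
    split : ∀ {a b} → a ⋖ b → upper a < upper b ⊎ lower b < lower a
    split (after q<k)  = inj₁ (1+2m<2n q<k)
    split (before k<p) = inj₂ (1+2m<2n k<p)

  -- Within one kind both keys order by index, and the two hypotheses read this order in opposite
  -- directions.
  same-kind : ∀ {x y} → x K₁.≲ y → y K₂.≲ x → kind (label x) ≡ kind (label y) → x ≡ y
  same-kind x≲y y≲x eq =
    toℕ-injective (ℕ.≤-antisym (K₁.key-tie eq x≲y) (K₂.key-tie (sym (kind≡⇒cokind≡ eq)) y≲x))

  ≲⇒⊑ : ∀ {x y} → x K₁.≲ y → y K₂.≲ x → x K₃.≲ y ⊎ y K₄.≲ x → x ⊑ y
  ≲⇒⊑ {x} {y} x≲₁y y≲₂x x≲₃y⊎y≲₄x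
    with label x | label y | same-kind {x} {y} x≲₁y y≲₂x | K₁.key-cancel-≤ {x} {y} x≲₁y
       | Sum.map (K₃.key-cancel-≤ {x} {y}) (K₄.key-cancel-≤ {y} {x}) x≲₃y⊎y≲₄x
  ... | interval _ _ | interval _ _ | same | _  | _           = inj₁ (same refl)
  ... | point _      | point _      | same | _  | _           = inj₁ (same refl)
  ... | point _      | interval _ _ | _    | () | _
  ... | interval _ _ | point _      | _    | _  | inj₁ uq≤uk  = inj₂ (after (1+2m≤2n⇒m<n uq≤uk))
  ... | interval _ _ | point _      | _    | _  | inj₂ lk≤lp  = inj₂ (before (1+2m≤2n⇒m<n lk≤lp))

  order : Fin 4 → LinearOrder poset
  order 0F = record { isDecTotalOrder = K₁.isDecTotalOrder }
  order 1F = record { isDecTotalOrder = Flip.isDecTotalOrder K₂.isDecTotalOrder }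
  order 2F = record { isDecTotalOrder = K₃.isDecTotalOrder }
  order 3F = record { isDecTotalOrder = Flip.isDecTotalOrder K₄.isDecTotalOrder }

  isYes-formula : ∀ {A B C D : Set} (a? : Dec A) (b? : Dec B) (c? : Dec C) (d? : Dec D) →
    (A × B × (C ⊎ D)) ⇔ (isYes a? ∧ isYes b? ∧ (isYes c? ∨ isYes d?)) ≡ true
  isYes-formula (yes a) (yes b) (yes c) _       = mk⇔ (λ _ → refl) (λ _ → a , b , inj₁ c)
  isYes-formula (yes a) (yes b) (no _)  (yes d) = mk⇔ (λ _ → refl) (λ _ → a , b , inj₂ d)
  isYes-formula (yes _) (yes _) (no ¬c) (no ¬d) =
    mk⇔ (λ (_ , _ , c⊎d) → contradiction c⊎d Sum.[ ¬c , ¬d ]) (λ ())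
  isYes-formula (yes _) (no ¬b) _       _       = mk⇔ (λ (_ , b , _) → contradiction b ¬b) (λ ())
  isYes-formula (no ¬a) _       _       _       = mk⇔ (λ (a , _) → contradiction a ¬a) (λ ())

  booleanRealizer : BooleanRealizer poset 4
  booleanRealizer = record
    { order    = order
    ; φ        = var 0F and var 1F and (var 2F or var 3F)
    ; realizes = λ x y →
        let formula = isYes-formula (K₁.key x ℕ.≤? K₁.key y) (K₂.key y ℕ.≤? K₂.key x)
                                    (K₃.key x ℕ.≤? K₃.key y) (K₄.key y ℕ.≤? K₄.key x)
        in mk⇔ (λ x⊑y → Equivalence.to formula (⊑⇒≲₁ x⊑y , ⊑⇒≳₂ x⊑y , ⊑⇒≲₃⊎≳₄ x⊑y))
               (λ eq → let x≲₁y , y≲₂x , x≲₃y⊎y≲₄x = Equivalence.from formula eq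
                       in ≲⇒⊑ x≲₁y y≲₂x x≲₃y⊎y≲₄x)
    }

  -- A local realizer of some finite width, from which the search for the minimum starts

  height : Fin N → Fin N → ℕ
  height v x = heightAt (label x) (x ≟ v) (v ⊑? x)

  module H v = Key (height v)

  height-mono : ∀ v {x y} → label x ⋖ label y → height v x < height v y
  height-mono v {x} {y} x⋖y =
    heightAt-mono x⋖y (x ≟ v) (v ⊑? x) (y ≟ v) (v ⊑? y) λ { refl → inj₂ x⋖y }

  -- The first two put intervals before points and list each kind by index, in opposite senses. The
  -- pairs left to reverse are an interval `v` and a point in it; the extension belonging to `v`
  -- does this.
  extensions : Fin (2 + N) → PartialLinearExtension poset
  extensions 0F            = totalOrder⇒extension (isTotalOrder K₁.isDecTotalOrder) ⊑⇒≲₁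
    where open IsDecTotalOrder
  extensions 1F            = totalOrder⇒extension (Flip.isTotalOrder (isTotalOrder K₂.isDecTotalOrder)) ⊑⇒≳₂
    where open IsDecTotalOrder
  extensions (suc (suc v)) = totalOrder⇒extension (isTotalOrder (H.isDecTotalOrder v)) λ where
      (inj₁ refl) → ℕ.≤-refl
      (inj₂ x⋖y)  → ℕ.<⇒≤ (H.key-mono-< v (height-mono v x⋖y))
    where open IsDecTotalOrder

  height-contained : ∀ {x y} → x K₁.≲ y → y K₂.≲ x → ¬ x ⊑ y → height x y < height x x
  height-contained {x} {y} x≲y y≲x x⋢y =
    heightAt-contained
      (ℕ.≤∧≢⇒< (K₁.key-cancel-≤ {x} {y} x≲y) (x⋢y ∘ inj₁ ∘ same-kind x≲y y≲x))
      (x ≟ x) (x ⊑? x) (y ≟ x) (x ⊑? y) refl x⋢y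

  extensions-reverse : ∀ {x y} → ¬ x ⊑ y → ∃[ i ] PartialLinearExtension._>ᵢ_ (extensions i) x y
  extensions-reverse {x} {y} x⋢y with K₁.key x ℕ.≤? K₁.key y | K₂.key y ℕ.≤? K₂.key x
  ... | no x≴y  | _       = 0F , _ , _ , ℕ.≰⇒≥ x≴y , x⋢y ∘ inj₁ ∘ sym
  ... | yes _   | no y≴x  = 1F , _ , _ , ℕ.≰⇒≥ y≴x , x⋢y ∘ inj₁ ∘ sym
  ... | yes x≲y | yes y≲x = suc (suc x) , _ , _ ,
    ℕ.<⇒≤ (H.key-mono-< x (height-contained x≲y y≲x x⋢y)) , x⋢y ∘ inj₁ ∘ sym

  localRealizer : LocalRealizer poset (2 + N)
  localRealizer = record
    { t         = 2 + N
    ; extension = extensions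
    ; width     = λ x → count≤n (λ i → PartialLinearExtension.ground? (extensions i) x) (allFin (2 + N))
    ; realizes  = λ x y → mk⇔
        (λ { x⊑y (i , x>y) → >ᵢ⇒⋢ (extensions i) x>y x⊑y })
        (λ none → decidable-stable (x ⊑? y) (none ∘ extensions-reverse))
    }

  -- The lower bound on the width of a local realizer

  data Inside (s e : ℕ) : Rel Label 0ℓ where
    inside : ∀ {p q k} → s ≤ p → p ≤ k → k ≤ q → q < e → Inside s e (interval p q) (point k)

  inside? : ∀ s e → Decidable (Inside s e)
  inside? s e (interval p q) (point k) =
    map′ (λ (s≤p , p≤k , k≤q , q<e) → inside s≤p p≤k k≤q q<e)
         (λ { (inside s≤p p≤k k≤q q<e) → s≤p , p≤k , k≤q , q<e })
         (s ℕ.≤? p ×-dec p ℕ.≤? k ×-dec k ℕ.≤? q ×-dec q ℕ.<? e)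
  inside? s e (interval _ _) (interval _ _) = no λ ()
  inside? s e (point _)      _              = no λ ()

  inside-mono : ∀ {s e s′ e′} → s ≤ s′ → e′ ≤ e → Inside s′ e′ ⇒ Inside s e
  inside-mono s≤s′ e′≤e (inside s′≤p p≤k k≤q q<e′) =
    inside (ℕ.≤-trans s≤s′ s′≤p) p≤k k≤q (ℕ.<-≤-trans q<e′ e′≤e)

  inside⇒⋢ : ∀ {s e x y} → Inside s e (label x) (label y) → ¬ x ⊑ y
  inside⇒⋢ in-xy (inj₁ refl) = irrefl in-xy
    where
    irrefl : ∀ {s e a} → ¬ Inside s e a a
    irrefl ()
  inside⇒⋢ in-xy (inj₂ x⋖y) = disjoint in-xy x⋖y
    where
    disjoint : ∀ {s e a b} → Inside s e a b → ¬ a ⋖ b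
    disjoint (inside _ _ k≤q _) (after q<k)  = ℕ.<⇒≱ q<k k≤q
    disjoint (inside _ p≤k _ _) (before k<p) = ℕ.<⇒≱ k<p p≤k

  inside-cross : ∀ {s e s′ e′ a b a′ b′} → e ≤ s′ → Inside s e a b → Inside s′ e′ a′ b′ →
                 a ⋖ b′ × a′ ⋖ b
  inside-cross e≤s′ (inside _ _ k≤q q<e) (inside s′≤p′ p′≤k′ _ _) =
    after (ℕ.<-≤-trans q<p′ p′≤k′) , before (ℕ.≤-<-trans k≤q q<p′)
    where q<p′ = ℕ.<-≤-trans q<e (ℕ.≤-trans e≤s′ s′≤p′)

  module _ {n : ℕ} (interval∈ : ∀ {p q} → p < n → q < n → ∃[ x ] label x ≡ interval p q)
                   (point∈ : ∀ {k} → k < n → ∃[ y ] label y ≡ point k)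
           {d : ℕ} (R : LocalRealizer poset d) where
    open Realizer R

    Internal : (s e : ℕ) → Fin t → Set
    Internal s e i = ∃[ x ] ∃[ y ] Inside s e (label x) (label y) × _>ᵢ_ i x y

    internal? : ∀ s e i → Dec (Internal s e i)
    internal? s e i = any? λ x → any? λ y → inside? s e (label x) (label y) ×-dec _>ᵢ?_ (extension i) x y

    internal-mono : ∀ {s e s′ e′ i} → s ≤ s′ → e′ ≤ e → Internal s′ e′ i → Internal s e i
    internal-mono s≤s′ e′≤e (x , y , in-xy , x>y) = x , y , inside-mono s≤s′ e′≤e in-xy , x>y

    -- For pairs from disjoint windows, each interval lies below the point of the other pair, so
    -- reversing both pairs is excluded by `>ᵢ-no-cross`.
    internal-disjoint : ∀ {s e s′ e′ i} → e ≤ s′ → Internal s e i → ¬ Internal s′ e′ i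
    internal-disjoint {i = i} e≤s′ (_ , _ , in-xy , x>y) (_ , _ , in-xy′ , x>y′)
      with x⋖y′ , x′⋖y ← inside-cross e≤s′ in-xy in-xy′
      = >ᵢ-no-cross (extension i) x>y x>y′ (inj₂ x⋖y′) (inj₂ x′⋖y)

    -- The c extensions in the vector take up width at y but are of no use for
    -- the pairs inside [s, e).
    Spared : ℕ → (s e : ℕ) → Fin N → Set
    Spared c s e y = Σ[ is ∈ Vec (Fin t) c ]
      (Unique is × All (λ i → Ground i y × ¬ Internal s e i) is)

    spared-bound : ∀ {c s e y} → Spared c s e y → c ≤ d
    spared-bound {y = y} (is , unique , all) = ℕ.≤-trans
      (injection⇒≤count (λ i → ground? i y) id (lookup is) (lookup-injective unique _ _)
        (λ j → proj₁ (lookup⁺ all j)))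
      (width y)

    -- Induction on the number `r` of remaining subdivisions. Each step passes to one of `suc d`
    -- blocks of the window and adds one spared extension at every point of it. At `r = 0` the
    -- window still has one point, which lies in `suc d` extensions, against the width.
    nested-blocks : ∀ r {c} → c + r ≡ suc d → ∀ s → s + suc d ^ r ≤ n →
      (∀ {y k} → label y ≡ point k → s ≤ k → k < s + suc d ^ r → Spared c s (s + suc d ^ r) y) → ⊥
    nested-blocks zero {c} eq s fits spared =
      ℕ.<⇒≱ (ℕ.≤-reflexive (trans (sym eq) (ℕ.+-identityʳ c)))
        (spared-bound (spared (proj₂ (point∈ (ℕ.<-≤-trans s<s+1 fits))) ℕ.≤-refl s<s+1))
      where
      s<s+1 : s < s + 1
      s<s+1 = ℕ.m<m+n s (s≤s z≤n)
    nested-blocks (suc r) {c} eq s fits spared =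
      nested-blocks r (trans (sym (ℕ.+-suc c r)) eq) (start j) (ℕ.≤-trans (block≤e j) fits) spared′
      where
      M e q : ℕ
      M = suc d ^ r
      e = s + suc d * M
      q = pred e

      s<e : s < e
      s<e = ℕ.m<m+n s (ℕ.m^n>0 (suc d) (suc r))

      instance
        e≢0 : NonZero e
        e≢0 = ℕ.>-nonZero (ℕ.≤-<-trans z≤n s<e)

      q<e : q < e
      q<e = ℕ.≤-reflexive (ℕ.suc-pred e)

      -- The window is half-open, so its last point is `pred e` and this interval contains all its
      -- points.
      whole : ∃[ x ] label x ≡ interval s q
      whole = interval∈ (ℕ.<-≤-trans s<e fits) (ℕ.<-≤-trans q<e fits)

      x = proj₁ whole

      start : Fin (suc d) → ℕ
      start j = s + toℕ j * M

      block≤ : ∀ j {m} → toℕ j < m → start j + M ≤ s + m * M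
      block≤ j {m} j<m = begin
        s + toℕ j * M + M   ≡⟨ ℕ.+-assoc s (toℕ j * M) M ⟩
        s + (toℕ j * M + M) ≡⟨ cong (s +_) (ℕ.+-comm (toℕ j * M) M) ⟩
        s + suc (toℕ j) * M ≤⟨ ℕ.+-monoʳ-≤ s (ℕ.*-monoˡ-≤ M j<m) ⟩
        s + m * M           ∎
        where open ℕ.≤-Reasoning

      block≤e : ∀ j → start j + M ≤ e
      block≤e j = block≤ j (toℕ<n j)

      Shared : Fin (suc d) → Set
      Shared j = ∃[ i ] Ground i x × Internal (start j) (start j + M) i

      shared? : ∀ j → Dec (Shared j)
      shared? j = any? λ i → ground? i x ×-dec internal? (start j) (start j + M) i

      shared-injective : ∀ {j j′} (sh : Shared j) (sh′ : Shared j′) → proj₁ sh ≡ proj₁ sh′ → j ≡ j′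
      shared-injective {j} {j′} (_ , _ , int) (_ , _ , int′) refl with <-cmp j j′
      ... | tri< j<j′ _ _ = contradiction int′ (internal-disjoint (block≤ j j<j′) int)
      ... | tri≈ _ j≡j′ _ = j≡j′
      ... | tri> _ _ j′<j = contradiction int (internal-disjoint (block≤ j′ j′<j) int′)

      -- Different blocks are disjoint, so if all were shared, `suc d` distinct extensions would
      -- contain `x`.
      unshared : ∃[ j ] ¬ Shared j
      unshared = ¬∀⟶∃¬ (suc d) Shared shared? λ shared → ℕ.<⇒≱
        (injection⇒≤count (λ i → ground? i x) id (proj₁ ∘ shared)
          (λ {j} {j′} → shared-injective (shared j) (shared j′)) (proj₁ ∘ proj₂ ∘ shared))
        (width x)

      j = proj₁ unshared

      s≤start : s ≤ start j
      s≤start = ℕ.m≤m+n s _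

      spared′ : ∀ {y k} → label y ≡ point k → start j ≤ k → k < start j + M →
                Spared (suc c) (start j) (start j + M) y
      spared′ {y} {k} ly start≤k k<end
        with is , unique , all ← spared ly (ℕ.≤-trans s≤start start≤k) (ℕ.<-≤-trans k<end (block≤e j))
        -- The new extension `i` reverses `x` and `y`, a pair inside the old window, so it differs
        -- from all of `is`. As it contains `x`, the choice of block `j` prevents it from reversing
        -- a pair inside that block.
        = i ∷ is ,
          All.map (λ { (_ , ¬int) refl → ¬int (x , y , in-xy , x>y) }) all ∷ unique ,
          (proj₁ (proj₂ x>y) , λ int → proj₂ unshared (i , proj₁ x>y , int)) ∷
          All.map (map₂ (_∘ internal-mono s≤start (block≤e j))) all
        where
        in-xy : Inside s e (label x) (label y)
        in-xy = subst₂ (Inside s e) (sym (proj₂ whole)) (sym ly)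
          (inside ℕ.≤-refl (ℕ.≤-trans s≤start start≤k)
            (ℕ.<⇒≤pred (ℕ.<-≤-trans k<end (block≤e j))) q<e)

        i = proj₁ (reversing (inside⇒⋢ in-xy))
        x>y = proj₂ (reversing (inside⇒⋢ in-xy))

    width-bound : ¬ suc d ^ suc d ≤ n
    width-bound fits = nested-blocks (suc d) refl 0 fits λ _ _ _ → [] , [] , []

-- The poset of all intervals and points below `n`

module Grid (n : ℕ) where

  -- Pairs with `p` greater than `q` are included as well; they act as empty intervals, lying below
  -- every point.
  intervalLabel : Fin n × Fin n → Label
  intervalLabel (p , q) = interval (toℕ p) (toℕ q)

  sumLabel : Fin (n * n) ⊎ Fin n → Label
  sumLabel = Sum.[ intervalLabel ∘ remQuot n , point ∘ toℕ ]

  label : Fin (n * n + n) → Label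
  label = sumLabel ∘ splitAt (n * n)

  interval∈ : ∀ {p q} → p < n → q < n → ∃[ x ] label x ≡ interval p q
  interval∈ p<n q<n = join (n * n) n (inj₁ (combine (fromℕ< p<n) (fromℕ< q<n))) , trans
    (cong sumLabel (splitAt-join (n * n) n (inj₁ (combine (fromℕ< p<n) (fromℕ< q<n)))))
    (trans (cong intervalLabel (remQuot-combine (fromℕ< p<n) (fromℕ< q<n)))
           (cong₂ interval (toℕ-fromℕ< p<n) (toℕ-fromℕ< q<n)))

  point∈ : ∀ {k} → k < n → ∃[ y ] label y ≡ point k
  point∈ k<n = join (n * n) n (inj₂ (fromℕ< k<n)) , trans
    (cong sumLabel (splitAt-join (n * n) n (inj₂ (fromℕ< k<n))))
    (cong point (toℕ-fromℕ< k<n))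

  open IntervalPoset label public

  localDimension : ∃ (IsLocalDimension poset)
  localDimension = least localRealizer? localRealizer

  -- Singletons and points as a standard example with nine pairs

  module _ (9≤n : 9 ≤ n) where

    i<n : (i : Fin 9) → toℕ i < n
    i<n i = ℕ.<-≤-trans (toℕ<n i) 9≤n

    singleton : (i : Fin 9) → ∃[ x ] label x ≡ interval (toℕ i) (toℕ i)
    singleton i = interval∈ (i<n i) (i<n i)

    element : (i : Fin 9) → ∃[ y ] label y ≡ point (toℕ i)
    element i = point∈ (i<n i)

    singleton⊑element : ∀ {i j} → i ≢ j → proj₁ (singleton i) ⊑ proj₁ (element j)
    singleton⊑element {i} {j} i≢j =
      inj₂ (subst₂ _⋖_ (sym (proj₂ (singleton i))) (sym (proj₂ (element j))) apart)
      where
      apart : interval (toℕ i) (toℕ i) ⋖ point (toℕ j)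
      apart with <-cmp i j
      ... | tri< i<j _ _ = after i<j
      ... | tri≈ _ i≡j _ = contradiction i≡j i≢j
      ... | tri> _ _ j<i = before j<i

    singleton⋢element : ∀ {i} → ¬ proj₁ (singleton i) ⊑ proj₁ (element i)
    singleton⋢element {i} = inside⇒⋢ (subst₂ (Inside 0 n) (sym (proj₂ (singleton i))) (sym (proj₂ (element i)))
      (inside z≤n ℕ.≤-refl ℕ.≤-refl (i<n i)))

    element⋢singleton : ∀ {i j} → ¬ proj₁ (element j) ⊑ proj₁ (singleton i)
    element⋢singleton {i} {j} (inj₁ eq)
      with () ← trans (sym (proj₂ (element j))) (trans (cong label eq) (proj₂ (singleton i)))
    element⋢singleton {i} {j} (inj₂ k⋖x)
      with () ← subst₂ _⋖_ (proj₂ (element j)) (proj₂ (singleton i)) k⋖x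

    singleton⋢singleton : ∀ {i j} → i ≢ j → ¬ proj₁ (singleton i) ⊑ proj₁ (singleton j)
    singleton⋢singleton {i} {j} i≢j (inj₁ eq) = i≢j (toℕ-injective (interval-injective
      (trans (sym (proj₂ (singleton i))) (trans (cong label eq) (proj₂ (singleton j))))))
      where
      interval-injective : ∀ {p q p′ q′} → interval p q ≡ interval p′ q′ → p ≡ p′
      interval-injective refl = refl
    singleton⋢singleton {i} {j} _ (inj₂ x⋖y)
      with () ← subst₂ _⋖_ (proj₂ (singleton i)) (proj₂ (singleton j)) x⋖y

    isBooleanDimension : IsBooleanDimension poset 4
    isBooleanDimension = booleanRealizer , StandardExample.4≤booleanDimension poset (proj₁ ∘ singleton) (proj₁ ∘ element)
      singleton⊑element singleton⋢element element⋢singleton singleton⋢singleton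

-- Separation of the two dimensions

module _ (m n : ℕ) (9≤n : 9 ≤ n) (large : suc m ^ suc m ≤ n) where
  open Grid n

  m<localDimension : ∀ {d} → LocalRealizer poset d → m < d
  m<localDimension {d} R = ℕ.≰⇒> λ d≤m → width-bound interval∈ point∈ R (begin
    suc d ^ suc d ≤⟨ ℕ.^-monoˡ-≤ (suc d) (s≤s d≤m) ⟩
    suc m ^ suc d ≤⟨ ℕ.^-monoʳ-≤ (suc m) (s≤s d≤m) ⟩
    suc m ^ suc m ≤⟨ large ⟩
    n             ∎)
    where open ℕ.≤-Reasoning

  separation : Σ[ P ∈ Poset 0ℓ 0ℓ 0ℓ ] (IsBooleanDimension P 4 × (∃[ d ] (IsLocalDimension P d × m < d)))
  separation = poset , isBooleanDimension 9≤n , map₂ (λ isMin → isMin , m<localDimension (proj₁ isMin)) localDimension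

mainTheorem2 : (m : ℕ) → .{{_ : NonZero m}} →
    Σ[ P ∈ Poset 0ℓ 0ℓ 0ℓ ]
    IsBooleanDimension P 4 × (∃[ d ] (IsLocalDimension P d × m < d))
-- The summand 9 makes room for the nine pairs of the standard example, the power for `suc m` nested
-- subdivisions into `suc m` blocks.
mainTheorem2 m = separation m (9 + suc m ^ suc m) (ℕ.m≤m+n 9 _) (ℕ.m≤n+m _ 9)
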